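{- Let $F$ be a graph with at least one edge and no isolated vertices such that $\delta(F)>\frac{|V(F)|-\alpha(F)}{2}$, and let $k\geq 3$. Then $\mathrm{sat}_k(n,\text{Berge- }F)=O(n)$ as $n\to\infty$.
   Context: $\delta(F)$ is the minimum degree and $\alpha(F)$ the independence number of $F$. A hypergraph $\mathcal{H}$ is a Berge-$F$ if $F$ and $\mathcal{H}$ can be embedded on a common vertex set with a bijection $\phi:E(F)\to E(\mathcal{H})$ such that $e\subseteq\phi(e)$ for all $e\in E(F)$; a hypergraph contains a Berge-$F$ if some subset of its edges forms a Berge-$F$. A $k$-uniform hypergraph $\mathcal{H}$ is Berge-$F$-saturated if it contains no Berge-$F$ but $\mathcal{H}+e$ contains a Berge-$F$ for every $k$-set $e\subseteq V(\mathcal{H})$ with $e\notin E(\mathcal{H})$. $\mathrm{sat}_k(n,\text{Berge- }F)$ is the minimum number of edges in a Berge-$F$-saturated $k$-uniform hypergraph on $n$ vertices. The paper assumes throughout that graphs have no isolated vertices. -}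

module Defs where

open import Data.Nat using (ℕ; _≤_; _<_; _*_; _∸_)
open import Data.Bool using (Bool; true; false)
open import Data.Fin using (Fin) renaming (_<_ to _<ᶠ_)
open import Data.Fin.Subset using (Subset; _∈_; _∉_; ∣_∣)
open import Data.Vec using (tabulate)
open import Data.List using (List; _∷_; length; lookup)
open import Data.List.Relation.Unary.All using (All)
open import Data.List.Relation.Unary.Unique.Propositional using (Unique)
import Data.List.Membership.Propositional as LM
open import Data.Product using (Σ; ∃; ∃-syntax; _×_)
open import Relation.Binary.PropositionalEquality using (_≡_)
open import Relation.Nullary using (¬_)
open import Function.Definitions using (Injective)

record Graph (m : ℕ) : Set where
  field
    adj     : Fin m → Fin m → Bool
    adj-sym : ∀ u v → adj u v ≡ adj v u
    adj-irr : ∀ u → adj u u ≡ false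
open Graph public

nbhd : ∀ {m} → Graph m → Fin m → Subset m
nbhd F v = tabulate (adj F v)

deg : ∀ {m} → Graph m → Fin m → ℕ
deg F v = ∣ nbhd F v ∣

HasEdge : ∀ {m} → Graph m → Set
HasEdge F = ∃[ u ] ∃[ v ] adj F u v ≡ true

NoIsolatedVertices : ∀ {m} → Graph m → Set
NoIsolatedVertices F = ∀ v → ∃[ u ] adj F v u ≡ true

IsMinDegree : ∀ {m} → Graph m → ℕ → Set
IsMinDegree F d = (∃[ v ] deg F v ≡ d) × (∀ v → d ≤ deg F v)

Independent : ∀ {m} → Graph m → Subset m → Set
Independent F S = ∀ u v → u ∈ S → v ∈ S → adj F u v ≡ false

IsIndependenceNumber : ∀ {m} → Graph m → ℕ → Set
IsIndependenceNumber F a =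
  (∃[ S ] Independent F S × ∣ S ∣ ≡ a) × (∀ S → Independent F S → ∣ S ∣ ≤ a)

-- δ(F) > (|V(F)| - α(F)) / 2, i.e. |V(F)| - α(F) < 2 δ(F)
-- (note α(F) ≤ |V(F)|, so truncated subtraction is exact)
DegreeCondition : ∀ {m} → Graph m → Set
DegreeCondition {m} F =
  ∀ d a → IsMinDegree F d → IsIndependenceNumber F a → m ∸ a < 2 * d

record Hypergraph (k n : ℕ) : Set where
  field
    edges   : List (Subset n)
    uniform : All (λ e → ∣ e ∣ ≡ k) edges
    simple  : Unique edges
open Hypergraph public

-- The list of (distinct) hyperedges es contains a Berge-F: an injective
-- vertex embedding f : V(F) → V(H) and an injective map φ from the edges
-- of F (each edge uv taken once, with u < v) to the hyperedges, with
-- {f u, f v} ⊆ φ(uv).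
ContainsBerge : ∀ {m n} → Graph m → List (Subset n) → Set
ContainsBerge {m} {n} F es =
  Σ (Fin m → Fin n) λ f → Injective _≡_ _≡_ f ×
  Σ ((u v : Fin m) → u <ᶠ v → adj F u v ≡ true → Fin (length es)) λ φ →
    (∀ u v u' v' p q p' q' → φ u v p q ≡ φ u' v' p' q' → u ≡ u' × v ≡ v') ×
    (∀ u v p q → f u ∈ lookup es (φ u v p q) × f v ∈ lookup es (φ u v p q))

BergeSaturated : ∀ {m k n} → Graph m → Hypergraph k n → Set
BergeSaturated {k = k} F H =
  ¬ ContainsBerge F (edges H) ×
  (∀ e → ∣ e ∣ ≡ k → ¬ (e LM.∈ edges H) → ContainsBerge F (e ∷ edges H))

numEdges : ∀ {k n} → Hypergraph k n → ℕ
numEdges H = length (edges H)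

{-# OPTIONS --safe #-}
-- Let S be a maximum independent set of F, a = |S| and t = |V(F)| - a - 1. Take a core of t
-- vertices, divide the remaining ones (up to a bounded number) into blocks of k - 1 vertices,
-- and let the hyperedges be E β j = β ∪ {core j}, t for each block; in t special blocks one
-- vertex is exchanged for a core vertex, so that any two core vertices are joined as well.
-- By the degree condition two vertices of F in one block would need 2 δ(F) - 1 > t hyperedges
-- of that block, which makes the vertices of F outside the core independent, and there are at
-- least a + 1 of those: the hypergraph has no Berge-F. Let H be a saturated hypergraph
-- containing it. If an ordinary vertex x lies in many new hyperedges, one can choose greedily
-- a Berge star of new hyperedges with centre x and a leaves, all in distinct blocks; together
-- with the core it carries a Berge-F. So new hyperedges at ordinary vertices are boundedly
-- many for each vertex, and there are boundedly many subsets of the remaining vertices.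
module Submission where

open import Defs
open import Data.Nat using (ℕ; zero; suc; _+_; _*_; _∸_; _^_; _≤_; _<_; _≟_; z≤n; s≤s)
open import Data.Nat.Properties hiding (_≟_)
open import Data.Bool using (true; false)
import Data.Bool.Properties as Bool
open import Data.Fin using (Fin; zero; suc; splitAt; join; inject≤; combine; remQuot) renaming (_<_ to _<ᶠ_)
import Data.Fin.Properties as Fin
open import Data.Fin.Subset using (Subset; inside; outside; _∈_; _∉_; _⊆_; ∣_∣; _∪_; ∁) renaming (⊥ to ∅; ⊤ to full)
open import Data.Fin.Subset.Properties
  using (_∈?_; _⊆?_; anySubset?; ∣⊥∣≡0; ∉⊥; ⊆⊤; ∣p∣≤n; x∈p∪q⁺; ∣∁p∣≡n∸∣p∣; x∉p⇒x∈∁p; x∈∁p⇒x∉p; drop-∷-⊆)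
open import Data.Vec using (Vec; []; _∷_; tabulate; here; there) renaming (lookup to lookupᵛ)
open import Data.Vec.Properties using (≡-dec; lookup∘tabulate; []=⇒lookup; lookup⇒[]=)
open import Data.List using (List; []; _∷_; _++_; length; lookup; map; concatMap; filter; allFin; deduplicate)
open import Data.List.Properties using (length-map; length-++; length-tabulate)
open import Data.List.Relation.Unary.All using (All; []; _∷_)
import Data.List.Relation.Unary.All as All
import Data.List.Relation.Unary.All.Properties as All
open import Data.List.Relation.Unary.Any using (Any; here; there; index)
import Data.List.Relation.Unary.Any as Any
open import Data.List.Relation.Unary.Any.Properties using (lookup-index)
open import Data.List.Relation.Unary.Unique.Propositional using (Unique; []; _∷_)
open import Data.List.Relation.Unary.Unique.DecPropositional.Properties using (deduplicate-!)
open import Data.List.Relation.Unary.Unique.Propositional.Properties using (filter⁺)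
open import Data.List.Membership.Propositional using (find) renaming (_∈_ to _∈ˡ_; _∉_ to _∉ˡ_)
open import Data.List.Membership.Propositional.Properties
  using (∈-map⁺; ∈-map⁻; ∈-++⁺ˡ; ∈-++⁺ʳ; ∈-lookup; ∈-filter⁺; ∈-filter⁻; ∈-concatMap⁺; ∈-concatMap⁻; ∈-allFin; ∈-deduplicate⁺; ∈-deduplicate⁻)
open import Data.Product using (Σ; ∃; ∃-syntax; ∃₂; _×_; _,_; proj₁; proj₂)
open import Data.Sum using (_⊎_; inj₁; inj₂; [_,_]′)
import Data.Sum as Sum
import Data.Sum.Properties as Sum
open import Data.Maybe using (Maybe; just; nothing)
open import Data.Maybe.Properties using (just-injective)
open import Data.Vec.Functional using () renaming (_∷_ to _∷ᶠ_)
open import Data.Nat.DivMod using (_/_; _%_; m%n<n; m≡m%n+[m/n]*n)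
open import Data.List.Extrema ≤-totalOrder using (argmin; argmax; argmax-all; f[argmin]≤f[xs]; f[xs]≤f[argmax])
open import Data.Sum.Function.Propositional using (_⊎-↔_)
open import Data.Product.Function.NonDependent.Propositional using (_×-↔_)
open import Function.Properties.Inverse using (↔-refl; ↔-trans)
open import Function using (_∘_; id; _↔_; Inverse)
open import Relation.Binary.PropositionalEquality
open import Relation.Binary using (tri<; tri≈; tri>)
open import Relation.Nullary using (¬_; Dec; yes; no; does; contradiction)
open import Relation.Nullary.Decidable using (map′; _×-dec_; _→-dec_; _⊎-dec_; ¬?; decidable-stable)
open import Relation.Unary using (Decidable)

-- Cardinalities of finite subsets

private variable
  m n a b o : ℕ

⊎-injective⇒≤ : (h : Fin a ⊎ Fin b → Fin o) → (∀ x y → h x ≡ h y → x ≡ y) → a + b ≤ o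
⊎-injective⇒≤ {a} {b} h inj = Fin.injective⇒≤ {f = h ∘ splitAt a} λ {x} {y} eq →
  trans (sym (Fin.join-splitAt a b x)) (trans (cong (join a b) (inj _ _ eq)) (Fin.join-splitAt a b y))

element : (p : Subset n) → Fin ∣ p ∣ → Fin n
element (inside  ∷ p) zero    = zero
element (inside  ∷ p) (suc i) = suc (element p i)
element (outside ∷ p) i       = suc (element p i)

element∈ : (p : Subset n) (i : Fin ∣ p ∣) → element p i ∈ p
element∈ (inside  ∷ p) zero    = here
element∈ (inside  ∷ p) (suc i) = there (element∈ p i)
element∈ (outside ∷ p) i       = there (element∈ p i)

element-injective : (p : Subset n) {i j : Fin ∣ p ∣} → element p i ≡ element p j → i ≡ j
element-injective (inside  ∷ p) {zero}  {zero}  eq = refl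
element-injective (inside  ∷ p) {suc i} {suc j} eq = cong suc (element-injective p (Fin.suc-injective eq))
element-injective (outside ∷ p) eq = element-injective p (Fin.suc-injective eq)

rank : {p : Subset n} {x : Fin n} → x ∈ p → Fin ∣ p ∣
rank {p = inside  ∷ p} here        = zero
rank {p = inside  ∷ p} (there x∈p) = suc (rank x∈p)
rank {p = outside ∷ p} (there x∈p) = rank x∈p

rank-injective : {p : Subset n} {x y : Fin n} (x∈p : x ∈ p) (y∈p : y ∈ p) →
                 rank x∈p ≡ rank y∈p → x ≡ y
rank-injective {p = inside  ∷ p} here        here        eq = refl
rank-injective {p = inside  ∷ p} (there x∈p) (there y∈p) eq =
  cong suc (rank-injective x∈p y∈p (Fin.suc-injective eq))
rank-injective {p = outside ∷ p} (there x∈p) (there y∈p) eq = cong suc (rank-injective x∈p y∈p eq)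

∣p∪q∣≤∣p∣+∣q∣ : (p q : Subset n) → ∣ p ∪ q ∣ ≤ ∣ p ∣ + ∣ q ∣
∣p∪q∣≤∣p∣+∣q∣ [] [] = z≤n
∣p∪q∣≤∣p∣+∣q∣ (inside  ∷ p) (inside  ∷ q) =
  s≤s (≤-trans (∣p∪q∣≤∣p∣+∣q∣ p q) (+-monoʳ-≤ ∣ p ∣ (n≤1+n ∣ q ∣)))
∣p∪q∣≤∣p∣+∣q∣ (inside  ∷ p) (outside ∷ q) = s≤s (∣p∪q∣≤∣p∣+∣q∣ p q)
∣p∪q∣≤∣p∣+∣q∣ (outside ∷ p) (inside  ∷ q) =
  ≤-trans (s≤s (∣p∪q∣≤∣p∣+∣q∣ p q)) (≤-reflexive (sym (+-suc ∣ p ∣ ∣ q ∣)))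
∣p∪q∣≤∣p∣+∣q∣ (outside ∷ p) (outside ∷ q) = ∣p∪q∣≤∣p∣+∣q∣ p q

module _ {P : Fin n → Set} (P? : Decidable P) where

  abstract
    comprehension : Subset n
    comprehension = tabulate (does ∘ P?)

    ∈-comprehension⁺ : ∀ {x} → P x → x ∈ comprehension
    ∈-comprehension⁺ {x} px = lookup⇒[]= x _ (trans (lookup∘tabulate _ x) (does-true (P? x)))
      where
      does-true : (d : Dec (P x)) → does d ≡ true
      does-true (yes _)  = refl
      does-true (no ¬px) = contradiction px ¬px

    ∈-comprehension⁻ : ∀ {x} → x ∈ comprehension → P x
    ∈-comprehension⁻ {x} x∈ = true-does (P? x) (trans (sym (lookup∘tabulate _ x)) ([]=⇒lookup x∈))
      where
      true-does : (d : Dec (P x)) → does d ≡ true → P x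
      true-does (yes px) _ = px

module _ (g : Fin a → Fin n) where

  private
    hit? : Decidable λ x → ∃ λ i → g i ≡ x
    hit? x = Fin.any? λ i → g i Fin.≟ x

  abstract
    image : Subset n
    image = comprehension hit?

    ∈-image⁺ : ∀ i → g i ∈ image
    ∈-image⁺ i = ∈-comprehension⁺ hit? (i , refl)

    ∈-image⁻ : ∀ {x} → x ∈ image → ∃ λ i → g i ≡ x
    ∈-image⁻ = ∈-comprehension⁻ hit?

  ∣image∣≤ : ∣ image ∣ ≤ a
  ∣image∣≤ = Fin.injective⇒≤ {f = λ i → proj₁ (pre i)} λ {i} {j} eq → element-injective image
    (trans (sym (proj₂ (pre i))) (trans (cong g eq) (proj₂ (pre j))))
    where pre = λ i → ∈-image⁻ (element∈ image i)

  ∣image∣≡ : (∀ {i j} → g i ≡ g j → i ≡ j) → ∣ image ∣ ≡ a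
  ∣image∣≡ inj = ≤-antisym ∣image∣≤
    (Fin.injective⇒≤ {f = rank ∘ ∈-image⁺} λ eq → inj (rank-injective (∈-image⁺ _) (∈-image⁺ _) eq))

-- Neighbourhoods, power sets and lists without repetition

∈-nbhd⁻ : (F : Graph m) {u v : Fin m} → v ∈ nbhd F u → adj F u v ≡ true
∈-nbhd⁻ F {u} {v} v∈ = trans (sym (lookup∘tabulate (adj F u) v)) ([]=⇒lookup v∈)

adj⇒≢ : (F : Graph m) {u v : Fin m} → adj F u v ≡ true → u ≢ v
adj⇒≢ F {u} uv refl with trans (sym uv) (adj-irr F u)
... | ()

powerset : Subset n → List (Subset n)
powerset []            = [] ∷ []
powerset (inside  ∷ p) = map (inside ∷_) (powerset p) ++ map (outside ∷_) (powerset p)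
powerset (outside ∷ p) = map (outside ∷_) (powerset p)

∈-powerset : {e p : Subset n} → e ⊆ p → e ∈ˡ powerset p
∈-powerset {e = []}          {[]}          e⊆p = here refl
∈-powerset {e = inside  ∷ e} {inside  ∷ p} e⊆p = ∈-++⁺ˡ (∈-map⁺ _ (∈-powerset (drop-∷-⊆ e⊆p)))
∈-powerset {e = outside ∷ e} {inside  ∷ p} e⊆p = ∈-++⁺ʳ _ (∈-map⁺ _ (∈-powerset (drop-∷-⊆ e⊆p)))
∈-powerset {e = inside  ∷ e} {outside ∷ p} e⊆p with e⊆p here
... | ()
∈-powerset {e = outside ∷ e} {outside ∷ p} e⊆p = ∈-map⁺ _ (∈-powerset (drop-∷-⊆ e⊆p))

length-powerset : (p : Subset n) → length (powerset p) ≡ 2 ^ ∣ p ∣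
length-powerset []            = refl
length-powerset (outside ∷ p) = trans (length-map _ (powerset p)) (length-powerset p)
length-powerset (inside  ∷ p) = trans (length-++ (map (inside ∷_) (powerset p)))
  (cong₂ _+_ (eq inside) (trans (eq outside) (sym (+-identityʳ _))))
  where eq = λ s → trans (length-map (s ∷_) (powerset p)) (length-powerset p)

module _ {A : Set} where

  lookup-injective : {xs : List A} → Unique xs → ∀ {i j} → lookup xs i ≡ lookup xs j → i ≡ j
  lookup-injective (_  ∷ _) {zero}  {zero}  eq = refl
  lookup-injective (x∉ ∷ _) {zero}  {suc j} eq = contradiction eq (All.lookup x∉ (∈-lookup j))
  lookup-injective (x∉ ∷ _) {suc i} {zero}  eq = contradiction (sym eq) (All.lookup x∉ (∈-lookup i))
  lookup-injective (_  ∷ u) {suc i} {suc j} eq = cong suc (lookup-injective u eq)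

  index-injective : {xs : List A} {x y : A} (x∈ : x ∈ˡ xs) (y∈ : y ∈ˡ xs) → index x∈ ≡ index y∈ → x ≡ y
  index-injective {xs} x∈ y∈ eq =
    trans (lookup-index x∈) (trans (cong (lookup xs) eq) (sym (lookup-index y∈)))

  Unique⇒length≤ : {xs ys : List A} → Unique xs → (∀ {x} → x ∈ˡ xs → x ∈ˡ ys) → length xs ≤ length ys
  Unique⇒length≤ {xs} uniq xs⊆ys = Fin.injective⇒≤ {f = λ i → index (xs⊆ys (∈-lookup {xs = xs} i))}
    λ eq → lookup-injective uniq (index-injective _ _ eq)

  length-concatMap≤ : {B : Set} (f : A → List B) (c : ℕ) → (∀ x → length (f x) ≤ c) →
                      ∀ xs → length (concatMap f xs) ≤ length xs * c
  length-concatMap≤ f c f≤c []       = z≤n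
  length-concatMap≤ f c f≤c (x ∷ xs) =
    ≤-trans (≤-reflexive (length-++ (f x))) (+-mono-≤ (f≤c x) (length-concatMap≤ f c f≤c xs))

  -- A function on `Fin n` is searched for as the vector of its values, one coordinate after the
  -- other.
  anyVec? : (∀ {P : A → Set} → Decidable P → Dec (∃ P)) →
            ∀ {n} {P : Vec A n → Set} → Decidable P → Dec (∃ P)
  anyVec? any {zero}  P? = map′ ([] ,_) (λ { ([] , p) → p }) (P? [])
  anyVec? any {suc n} P? = map′ (λ (x , xs , p) → x ∷ xs , p) (λ { (x ∷ xs , p) → x , xs , p })
    (any λ x → anyVec? any λ xs → P? (x ∷ xs))

-- Berge copies of a graph and their decidability

_≟ˢ_ : (p q : Subset n) → Dec (p ≡ q)
_≟ˢ_ = ≡-dec Bool._≟_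

_∈ˡ?_ : (e : Subset n) (es : List (Subset n)) → Dec (e ∈ˡ es)
_∈ˡ?_ = Membership._∈?_ where import Data.List.Membership.DecPropositional _≟ˢ_ as Membership

-- Equality of unordered pairs.
SamePair : {A : Set} → A × A → A × A → Set
SamePair (u , v) (u′ , v′) = (u ≡ u′ × v ≡ v′) ⊎ (u ≡ v′ × v ≡ u′)

SamePair-sym : {A : Set} {p q : A × A} → SamePair p q → SamePair q p
SamePair-sym (inj₁ (refl , refl)) = inj₁ (refl , refl)
SamePair-sym (inj₂ (refl , refl)) = inj₂ (refl , refl)

SamePair-trans : {A : Set} {p q r : A × A} → SamePair p q → SamePair q r → SamePair p r
SamePair-trans (inj₁ (refl , refl)) s = s
SamePair-trans (inj₂ (refl , refl)) (inj₁ (refl , refl)) = inj₂ (refl , refl)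
SamePair-trans (inj₂ (refl , refl)) (inj₂ (refl , refl)) = inj₁ (refl , refl)

-- ψ assigns a hyperedge to ordered pairs; the values at (u , v) and (v , u) need not agree,
-- and its values at non-edges of F are irrelevant.
IsBerge : Graph m → (Subset n → Set) → (Fin m → Fin n) → (Fin m → Fin m → Subset n) → Set
IsBerge F E f ψ =
  (∀ u v → f u ≡ f v → u ≡ v) ×
  (∀ u v → adj F u v ≡ true → E (ψ u v) × f u ∈ ψ u v × f v ∈ ψ u v) ×
  (∀ u v u′ v′ → adj F u v ≡ true → adj F u′ v′ ≡ true → ψ u v ≡ ψ u′ v′ → SamePair (u , v) (u′ , v′))

Berge : Graph m → (Subset n → Set) → Set
Berge F E = ∃₂ (IsBerge F E)

Berge-mono : (F : Graph m) {E E′ : Subset n → Set} → (∀ {e} → E e → E′ e) → Berge F E → Berge F E′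
Berge-mono F E⇒E′ (f , ψ , f-inj , good , ψ-inj) =
  f , ψ , f-inj , (λ u v uv → let e , fu , fv = good u v uv in E⇒E′ e , fu , fv) , ψ-inj

-- For replacing f and ψ by their tables of values, which agree with them only pointwise.
IsBerge-cong : (F : Graph m) {E : Subset n → Set} {f f′ : Fin m → Fin n} {ψ ψ′ : Fin m → Fin m → Subset n} →
               (∀ u → f u ≡ f′ u) → (∀ u v → ψ u v ≡ ψ′ u v) → IsBerge F E f ψ → IsBerge F E f′ ψ′
IsBerge-cong F {E} f≗ ψ≗ (f-inj , good , ψ-inj) =
  (λ u v eq → f-inj u v (trans (f≗ u) (trans eq (sym (f≗ v))))) ,
  (λ u v uv → let e , fu , fv = good u v uv in
     subst E (ψ≗ u v) e , subst₂ _∈_ (f≗ u) (ψ≗ u v) fu , subst₂ _∈_ (f≗ v) (ψ≗ u v) fv) ,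
  λ u v u′ v′ uv uv′ eq → ψ-inj u v u′ v′ uv uv′ (trans (ψ≗ u v) (trans eq (sym (ψ≗ u′ v′))))

-- There are finitely many tables for f and ψ, so all can be tried. The greedy extension has to
-- decide whether a candidate creates a Berge-F.
Berge? : (F : Graph m) {E : Subset n → Set} → Decidable E → Dec (Berge F E)
Berge? {m} {n} F {E} E? = map′
  (λ (fs , ψs , isB) → lookupᵛ fs , (λ u v → lookupᵛ (lookupᵛ ψs u) v) , isB)
  (λ (f , ψ , isB) → tabulate f , tabulate (λ u → tabulate (ψ u)) ,
     IsBerge-cong F {E} (λ u → sym (lookup∘tabulate f u))
       (λ u v → sym (trans (cong (λ row → lookupᵛ row v) (lookup∘tabulate _ u)) (lookup∘tabulate (ψ u) v))) isB)
  (anyVec? Fin.any? λ fs → anyVec? (anyVec? anySubset?) λ ψs →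
    isBerge? (lookupᵛ fs) (λ u v → lookupᵛ (lookupᵛ ψs u) v))
  where
  isBerge? : ∀ f ψ → Dec (IsBerge F E f ψ)
  isBerge? f ψ =
    (Fin.all? λ u → Fin.all? λ v → f u Fin.≟ f v →-dec u Fin.≟ v) ×-dec
    (Fin.all? λ u → Fin.all? λ v → adj F u v Bool.≟ true →-dec
       E? (ψ u v) ×-dec (f u ∈? ψ u v) ×-dec (f v ∈? ψ u v)) ×-dec
    (Fin.all? λ u → Fin.all? λ v → Fin.all? λ u′ → Fin.all? λ v′ →
       adj F u v Bool.≟ true →-dec adj F u′ v′ Bool.≟ true →-dec ψ u v ≟ˢ ψ u′ v′ →-dec
       ((u Fin.≟ u′ ×-dec v Fin.≟ v′) ⊎-dec (u Fin.≟ v′ ×-dec v Fin.≟ u′)))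

Berge⇒ContainsBerge : (F : Graph m) {es : List (Subset n)} → Berge F (_∈ˡ es) → ContainsBerge F es
Berge⇒ContainsBerge F {es} (f , ψ , f-inj , good , ψ-inj) =
  f , (λ {u} {v} → f-inj u v) , (λ u v _ uv → index (mem uv)) , φ-inj ,
  λ u v _ uv → let _ , fu , fv = good u v uv in
    subst (f u ∈_) (lookup-index (mem uv)) fu , subst (f v ∈_) (lookup-index (mem uv)) fv
  where
  mem : ∀ {u v} → adj F u v ≡ true → ψ u v ∈ˡ es
  mem {u} {v} uv = proj₁ (good u v uv)
  φ-inj : ∀ u v u′ v′ → u <ᶠ v → ∀ uv → u′ <ᶠ v′ → ∀ uv′ →
          index (mem {u} {v} uv) ≡ index (mem {u′} {v′} uv′) → u ≡ u′ × v ≡ v′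
  φ-inj u v u′ v′ u<v uv u′<v′ uv′ eq with ψ-inj u v u′ v′ uv uv′ (index-injective (mem uv) (mem uv′) eq)
  ... | inj₁ same          = same
  ... | inj₂ (refl , refl) = contradiction u′<v′ (<-asym u<v)

-- The map φ is injective into positions of the list, while ψ has to be injective into sets; as the
-- list has no repetitions, equal sets have equal positions.
ContainsBerge⇒Berge : (F : Graph m) {es : List (Subset n)} → Unique es → ContainsBerge F es → Berge F (_∈ˡ es)
ContainsBerge⇒Berge {m} {n} F {es} uniq (f , f-inj , φ , φ-inj , good) =
  f , ψ , (λ _ _ → f-inj) ,
  (λ u v uv → let u′ , v′ , p , q , same , eq = orient u v uv in
     subst (λ e → e ∈ˡ es × f u ∈ e × f v ∈ e) (sym eq) (∈-lookup (φ u′ v′ p q) , ends same (good u′ v′ p q))) ,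
  λ u v x y uv xy eq → let u′ , v′ , p , q , same , eq₁ = orient u v uv
                           x′ , y′ , r , s , same′ , eq₂ = orient x y xy
                           u′≡x′ , v′≡y′ = φ-inj u′ v′ x′ y′ p q r s
                             (lookup-injective uniq (trans (sym eq₁) (trans eq eq₂)))
    in SamePair-trans same (SamePair-trans (inj₁ (u′≡x′ , v′≡y′)) (SamePair-sym same′))
  where
  ψ : Fin m → Fin m → Subset n
  ψ u v with adj F u v Bool.≟ true | Fin.<-cmp u v
  ... | yes uv | tri< u<v _ _ = lookup es (φ u v u<v uv)
  -- Here and at non-edges the value is a mere default: adjacent vertices are distinct.
  ... | yes uv | tri≈ _ _ _   = ∅
  ... | yes uv | tri> _ _ v<u = lookup es (φ v u v<u (trans (adj-sym F v u) uv))
  ... | no _   | _            = ∅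
  orient : ∀ u v → adj F u v ≡ true → ∃₂ λ u′ v′ → Σ (u′ <ᶠ v′) λ p → Σ (adj F u′ v′ ≡ true) λ q →
           SamePair (u , v) (u′ , v′) × ψ u v ≡ lookup es (φ u′ v′ p q)
  orient u v uv with adj F u v Bool.≟ true | Fin.<-cmp u v
  ... | yes uv | tri< u<v _ _ = u , v , u<v , uv , inj₁ (refl , refl) , refl
  ... | yes uv | tri≈ _ u≡v _ = contradiction u≡v (adj⇒≢ F uv)
  ... | yes uv | tri> _ _ v<u = v , u , v<u , trans (adj-sym F v u) uv , inj₂ (refl , refl) , refl
  ... | no ¬uv | _            = contradiction uv ¬uv
  ends : ∀ {u v u′ v′ e} → SamePair (u , v) (u′ , v′) → f u′ ∈ e × f v′ ∈ e → f u ∈ e × f v ∈ e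
  ends (inj₁ (refl , refl)) (x , y) = x , y
  ends (inj₂ (refl , refl)) (x , y) = y , x

-- Extension to a saturated hypergraph

maximal-extension : (F : Graph m) {k : ℕ} (cands es : List (Subset n)) →
  All (λ e → ∣ e ∣ ≡ k) cands → All (λ e → ∣ e ∣ ≡ k) es → Unique es → ¬ Berge F (_∈ˡ es) →
  Σ (Hypergraph k n) λ H → (∀ {e} → e ∈ˡ es → e ∈ˡ edges H) × ¬ Berge F (_∈ˡ edges H) ×
    (∀ {e} → e ∈ˡ cands → e ∈ˡ edges H ⊎ Berge F (_∈ˡ (e ∷ edges H)))
maximal-extension F [] es _ size uniq free =
  record { edges = es ; uniform = size ; simple = uniq } , id , free , λ ()
maximal-extension F (c ∷ cs) es (|c| ∷ |cs|) size uniq free with c ∈ˡ? es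
... | yes c∈es = let H , es⊆H , Hfree , sat = maximal-extension F cs es |cs| size uniq free in
      H , es⊆H , Hfree , λ { (here refl) → inj₁ (es⊆H c∈es) ; (there e∈) → sat e∈ }
... | no c∉es with Berge? F (_∈ˡ? (c ∷ es))
-- The Berge-F created by the rejected candidate `c` survives all later additions, so `c` need not
-- be examined again.
...   | yes B = let H , es⊆H , Hfree , sat = maximal-extension F cs es |cs| size uniq free in
        H , es⊆H , Hfree ,
        λ { (here refl) → inj₂ (Berge-mono F {_∈ˡ (c ∷ es)} (λ { (here eq) → here eq ; (there e∈) → there (es⊆H e∈) }) B)
          ; (there e∈) → sat e∈ }
...   | no ¬B = let H , es⊆H , Hfree , sat = maximal-extension F cs (c ∷ es) |cs| (|c| ∷ size)
                      (All.¬Any⇒All¬ es c∉es ∷ uniq) ¬B in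
        H , es⊆H ∘ there , Hfree , λ { (here refl) → inj₁ (es⊆H (here refl)) ; (there e∈) → sat e∈ }

saturated-extension : (F : Graph m) {k : ℕ} (es : List (Subset n)) →
  All (λ e → ∣ e ∣ ≡ k) es → Unique es → ¬ Berge F (_∈ˡ es) →
  Σ (Hypergraph k n) λ H → (∀ {e} → e ∈ˡ es → e ∈ˡ edges H) × ¬ Berge F (_∈ˡ edges H) × BergeSaturated F H
saturated-extension {n = n} F {k} es size uniq free =
  let H , es⊆H , Hfree , sat = maximal-extension F cands es (All.all-filter _ (powerset full)) size uniq free in
  H , es⊆H , Hfree , Hfree ∘ ContainsBerge⇒Berge F (simple H) , λ e |e| e∉H →
    [ (λ e∈H → contradiction e∈H e∉H) , Berge⇒ContainsBerge F ]′ (sat (∈-filter⁺ _ (∈-powerset ⊆⊤) |e|))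
  where
  cands : List (Subset n)
  cands = filter (λ e → ∣ e ∣ ≟ k) (powerset full)

-- Greedy choice of hyperedges and vertices

avoiding-edge : ∀ {K} {L : List (Subset n)} → Unique L → 2 ^ K < length L →
                ∀ Q → ∣ Q ∣ ≤ K → ∃₂ λ e x → e ∈ˡ L × x ∈ e × x ∉ Q
avoiding-edge {K = K} {L} uniq large Q |Q|≤K with All.all? (_⊆? Q) L
-- `Q` has at most 2 ^ K subsets, fewer than the distinct members of `L`.
... | yes all⊆ = contradiction
  (≤-trans (Unique⇒length≤ uniq (∈-powerset ∘ All.lookup all⊆))
    (≤-trans (≤-reflexive (length-powerset Q)) (^-monoʳ-≤ 2 |Q|≤K)))
  (<⇒≱ large)
... | no ¬all⊆ with find (All.¬All⇒Any¬ (_⊆? Q) L ¬all⊆)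
...   | e , e∈L , e⊈Q with Fin.any? (λ x → (x ∈? e) ×-dec ¬? (x ∈? Q))
...     | yes (x , x∈e , x∉Q) = e , x , e∈L , x∈e , x∉Q
...     | no none = contradiction
  (λ {x} x∈e → decidable-stable (x ∈? Q) λ x∉Q → none (x , x∈e , x∉Q)) e⊈Q

-- Once `e₀` and `x₀` are chosen, `e₀` and the cell of `x₀` join the forbidden set `Q`; this costs
-- at most `c`, and `K` has room for `s` such steps. A later vertex lies outside `e₀`, so its
-- hyperedge is a different one, and outside the cell of `x₀`. Only later vertices avoid earlier
-- cells, whence the disjunction at the end.
greedy : (cell : Fin n → Subset n) (c K : ℕ) (L : List (Subset n)) →
         (∀ {e} x → e ∈ˡ L → ∣ e ∪ cell x ∣ ≤ c) →
         (∀ Q → ∣ Q ∣ ≤ K → ∃₂ λ e x → e ∈ˡ L × x ∈ e × x ∉ Q) →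
         ∀ s Q → ∣ Q ∣ + s * c ≤ K →
         Σ (Fin s → Subset n) λ e → Σ (Fin s → Fin n) λ x →
           (∀ i → e i ∈ˡ L × x i ∈ e i × x i ∉ Q) ×
           (∀ i j → e i ≡ e j → i ≡ j) ×
           (∀ i j → i ≢ j → x i ∉ cell (x j) ⊎ x j ∉ cell (x i))
greedy cell c K L bound choose zero Q _ = (λ ()) , (λ ()) , (λ ()) , (λ ()) , λ ()
greedy {n} cell c K L bound choose (suc s) Q small
  with e₀ , x₀ , e₀∈L , x₀∈e₀ , x₀∉Q ← choose Q (m+n≤o⇒m≤o ∣ Q ∣ small)
  with e , x , good , e-inj , apart ← greedy cell c K L bound choose s (Q ∪ (e₀ ∪ cell x₀))
    (≤-trans (+-monoˡ-≤ (s * c) (≤-trans (∣p∪q∣≤∣p∣+∣q∣ Q _) (+-monoʳ-≤ ∣ Q ∣ (bound x₀ e₀∈L))))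
      (≤-trans (≤-reflexive (+-assoc ∣ Q ∣ c (s * c))) small))
  = e₀ ∷ᶠ e , x₀ ∷ᶠ x ,
    (λ { zero → e₀∈L , x₀∈e₀ , x₀∉Q
       ; (suc i) → let e∈L , x∈e , x∉ = good i in e∈L , x∈e , x∉ ∘ x∈p∪q⁺ ∘ inj₁ }) ,
    (λ { zero    zero    _  → refl
       ; zero    (suc j) eq → contradiction (sym eq) (e≢e₀ j)
       ; (suc i) zero    eq → contradiction eq (e≢e₀ i)
       ; (suc i) (suc j) eq → cong suc (e-inj i j eq) }) ,
    λ { zero    zero    i≢j → contradiction refl i≢j
      ; zero    (suc j) _   → inj₂ (x∉cell j)
      ; (suc i) zero    _   → inj₁ (x∉cell i)
      ; (suc i) (suc j) i≢j → apart i j (i≢j ∘ cong suc) }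
  where
  x∉ : ∀ i → x i ∉ Q ∪ (e₀ ∪ cell x₀)
  x∉ i = proj₂ (proj₂ (good i))
  x∉cell : ∀ i → x i ∉ cell x₀
  x∉cell i x∈ = x∉ i (x∈p∪q⁺ (inj₂ (x∈p∪q⁺ (inj₂ x∈))))
  e≢e₀ : ∀ i → e i ≢ e₀
  e≢e₀ i eq = x∉ i (x∈p∪q⁺ (inj₂ (x∈p∪q⁺ (inj₁ (subst (x i ∈_) eq (proj₁ (proj₂ (good i))))))))

-- The core, the blocks and their hyperedges

pattern core i   = inj₁ i
pattern priv β l = inj₂ (inj₁ (β , l))
pattern spare s  = inj₂ (inj₂ s)

-- `inj₁ i` is the special block assigned to `core i`; the blocks `inj₂ β` are the normal ones.
Block : ℕ → ℕ → Set
Block t q = Fin t ⊎ Fin q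

-- With k = 3 + b, a block has k - 1 = 2 + b vertices; the `r` spare vertices are left over by the
-- division into blocks.
Vertex : (t q r b : ℕ) → Set
Vertex t q r b = Fin t ⊎ ((Block t q × Fin (2 + b)) ⊎ Fin r)

module Construction (t q r b : ℕ) (iso : Fin n ↔ Vertex t q r b) where

  open Inverse iso using () renaming (to to loc; from to at; strictlyInverseˡ to loc-at; strictlyInverseʳ to at-loc)

  at-injective : ∀ {v w} → at v ≡ at w → v ≡ w
  at-injective {v} {w} eq = trans (sym (loc-at v)) (trans (cong loc eq) (loc-at w))

  loc-injective : ∀ {x y} → loc x ≡ loc y → x ≡ y
  loc-injective {x} {y} eq = trans (sym (at-loc x)) (trans (cong at eq) (at-loc y))

  -- In the special block inj₁ i the zeroth member gives way to core i, so that the hyperedges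
  -- of this block join core i to the rest of the core.
  second : Block t q → Fin t → Vertex t q r b
  second (inj₁ i) j with i Fin.≟ j
  ... | yes _ = priv (inj₁ i) zero
  ... | no  _ = core i
  second (inj₂ β) j = priv (inj₂ β) zero

  slot : Block t q → Fin t → Fin (3 + b) → Vertex t q r b
  slot β j zero          = core j
  slot β j (suc zero)    = second β j
  slot β j (suc (suc l)) = priv β (suc l)

  -- For i = j the zeroth member stays, because `core i` already occupies slot zero.
  second-cases : ∀ β j → second β j ≡ priv β zero ⊎ (∃ λ i → β ≡ inj₁ i × i ≢ j × second β j ≡ core i)
  second-cases (inj₁ i) j with i Fin.≟ j
  ... | yes _  = inj₁ refl
  ... | no i≢j = inj₂ (i , refl , i≢j , refl)
  second-cases (inj₂ β) j = inj₁ refl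

  second-special : ∀ i j → i ≡ j ⊎ second (inj₁ i) j ≡ core i
  second-special i j with i Fin.≟ j
  ... | yes i≡j = inj₁ i≡j
  ... | no  _   = inj₂ refl

  slot-injective : ∀ β j {l l′} → slot β j l ≡ slot β j l′ → l ≡ l′
  slot-injective β j {zero} {zero} eq = refl
  slot-injective β j {suc zero} {suc zero} eq = refl
  slot-injective β j {suc (suc l)} {suc (suc .l)} refl = refl
  slot-injective β j {zero} {suc zero} eq with second-cases β j
  ... | inj₁ eq′ with () ← trans eq eq′
  ... | inj₂ (i , _ , i≢j , eq′) with refl ← trans eq eq′ = contradiction refl i≢j
  slot-injective β j {suc zero} {zero} eq with second-cases β j
  ... | inj₁ eq′ with () ← trans (sym eq) eq′
  ... | inj₂ (i , _ , i≢j , eq′) with refl ← trans (sym eq) eq′ = contradiction refl i≢j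
  slot-injective β j {suc zero} {suc (suc l)} eq with second-cases β j
  ... | inj₁ eq′ with () ← trans (sym eq) eq′
  ... | inj₂ (i , _ , i≢j , eq′) with () ← trans (sym eq) eq′
  slot-injective β j {suc (suc l)} {suc zero} eq with second-cases β j
  ... | inj₁ eq′ with () ← trans eq eq′
  ... | inj₂ (i , _ , i≢j , eq′) with () ← trans eq eq′

  E : Block t q → Fin t → Subset n
  E β j = image (at ∘ slot β j)

  ∣E∣ : ∀ β j → ∣ E β j ∣ ≡ 3 + b
  ∣E∣ β j = ∣image∣≡ _ (slot-injective β j ∘ at-injective)

  core∈E : ∀ β j → at (core j) ∈ E β j
  core∈E β j = ∈-image⁺ _ zero

  member∈E : ∀ β j l → at (priv β (suc l)) ∈ E β j
  member∈E β j l = ∈-image⁺ _ (suc (suc l))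

  normal∈E : ∀ β j l → at (priv (inj₂ β) l) ∈ E (inj₂ β) j
  normal∈E β j zero    = ∈-image⁺ _ (suc zero)
  normal∈E β j (suc l) = member∈E (inj₂ β) j l

  -- The purpose of the special blocks: as `core i` lies in all t hyperedges of its block,
  -- `E (inj₁ i) j` joins it to `core j`.
  special-core∈E : ∀ i j → at (core i) ∈ E (inj₁ i) j
  special-core∈E i j with second-special i j
  ... | inj₁ refl = core∈E (inj₁ i) i
  ... | inj₂ eq   = subst (_∈ E (inj₁ i) j) (cong at eq) (∈-image⁺ _ (suc zero))

  E-cases : ∀ {β j} v → at v ∈ E β j →
            (∃ λ l → v ≡ priv β l) ⊎ (∃ λ i → v ≡ core i × (i ≡ j ⊎ β ≡ inj₁ i))
  E-cases {β} {j} v v∈ with ∈-image⁻ (at ∘ slot β j) v∈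
  ... | zero , eq = inj₂ (j , sym (at-injective eq) , inj₁ refl)
  ... | suc (suc l) , eq = inj₁ (suc l , sym (at-injective eq))
  ... | suc zero , eq with second-cases β j
  ...   | inj₁ eq′ = inj₁ (zero , trans (sym (at-injective eq)) eq′)
  ...   | inj₂ (i , β≡ , _ , eq′) = inj₂ (i , trans (sym (at-injective eq)) eq′ , inj₂ β≡)

  priv∈E⇒≡ : ∀ {β β′ j l} → at (priv β l) ∈ E β′ j → β ≡ β′
  priv∈E⇒≡ {β} {l = l} v∈ with E-cases (priv β l) v∈
  ... | inj₁ (_ , refl) = refl

  core∈E⇒ : ∀ {i β j} → at (core i) ∈ E β j → i ≡ j ⊎ β ≡ inj₁ i
  core∈E⇒ {i} v∈ with E-cases (core i) v∈
  ... | inj₂ (_ , refl , c) = c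

  -- The block is read off from `priv β (suc zero)`, which exists as k is at least 3 and is never
  -- exchanged. Then `j` and `j′` agree, unless `core j` and `core j′` are both the vertex assigned
  -- to the block, and in that case they agree as well.
  E-injective : ∀ {β j β′ j′} → E β j ≡ E β′ j′ → β ≡ β′ × j ≡ j′
  E-injective {β} {j} {β′} {j′} eq
    with refl ← priv∈E⇒≡ {j = j′} (subst (_ ∈_) eq (member∈E β j zero))
    with core∈E⇒ (subst (_ ∈_) eq (core∈E β j)) | core∈E⇒ (subst (_ ∈_) (sym eq) (core∈E β j′))
  ... | inj₁ j≡j′ | _           = refl , j≡j′
  ... | inj₂ _    | inj₁ j′≡j   = refl , sym j′≡j
  ... | inj₂ refl | inj₂ refl   = refl , refl

  blocks : List (Block t q)
  blocks = map inj₁ (allFin t) ++ map inj₂ (allFin q)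

  ∈-blocks : ∀ β → β ∈ˡ blocks
  ∈-blocks (inj₁ i) = ∈-++⁺ˡ (∈-map⁺ inj₁ (∈-allFin i))
  ∈-blocks (inj₂ β) = ∈-++⁺ʳ _ (∈-map⁺ inj₂ (∈-allFin β))

  seeds : List (Subset n)
  seeds = concatMap (λ β → map (E β) (allFin t)) blocks

  ∈-seeds⁺ : ∀ β j → E β j ∈ˡ seeds
  ∈-seeds⁺ β j = ∈-concatMap⁺ _ (Any.map (λ { refl → ∈-map⁺ (E β) (∈-allFin j) }) (∈-blocks β))

  ∈-seeds⁻ : ∀ {e} → e ∈ˡ seeds → ∃₂ λ β j → e ≡ E β j
  ∈-seeds⁻ e∈ with β , e∈β ← Any.satisfied (∈-concatMap⁻ (λ β → map (E β) (allFin t)) {xs = blocks} e∈)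
    with j , _ , eq ← ∈-map⁻ (E β) e∈β = β , j , eq

  -- Every block owns its zeroth member, so there are at most n blocks, with t hyperedges each.
  length-seeds : length seeds ≤ n * t
  length-seeds = ≤-trans
    (length-concatMap≤ _ t (λ β → ≤-reflexive (trans (length-map (E β) (allFin t)) (length-tabulate id))) blocks)
    (*-monoˡ-≤ t (≤-trans (≤-reflexive blocks-length)
      (⊎-injective⇒≤ (λ β → at (priv β zero)) λ { _ _ eq → priv-zero-injective (at-injective eq) })))
    where
    blocks-length : length blocks ≡ t + q
    blocks-length = trans (length-++ (map inj₁ (allFin t))) (cong₂ _+_
      (trans (length-map inj₁ (allFin t)) (length-tabulate {n = t} id))
      (trans (length-map inj₂ (allFin q)) (length-tabulate {n = q} id)))
    priv-zero-injective : ∀ {β β′} → _≡_ {A = Vertex t q r b} (priv β zero) (priv β′ zero) → β ≡ β′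
    priv-zero-injective refl = refl

  -- The seeds contain no Berge-F

  seeds-free : (F : Graph m) (d a : ℕ) → (∀ v → d ≤ deg F v) → (∀ S → Independent F S → ∣ S ∣ ≤ a) →
               suc t < d + d → a + t < m → ¬ Berge F (_∈ˡ seeds)
  seeds-free {m} F d a d≤deg indep≤a t<2d a+t<m (f , ψ , f-inj , good , ψ-inj) =
    -- At most a vertices of F are embedded off the core, by independence, and at most t in it; but
    -- a + t < m.
    <⇒≱ a+t<m (≤-trans (m≤n+m∸n m ∣ outer ∣)
      (+-mono-≤ (indep≤a outer outer-independent) (≤-trans (≤-reflexive (sym (∣∁p∣≡n∸∣p∣ outer))) inner≤t)))
    where
    InBlock : Block t q → Fin m → Set
    InBlock β u = ∃ λ l → loc (f u) ≡ priv β l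

    at-of : ∀ {u v} → loc (f u) ≡ v → f u ≡ at v
    at-of {u} eq = trans (sym (at-loc (f u))) (cong at eq)

    -- Private vertices of β lie in no seeds of other blocks. Hence only t labels are available to
    -- all edges of F at vertices in one block.
    label : ∀ {β u} → InBlock β u → ∀ {w} → adj F u w ≡ true → ∃ λ j → ψ u w ≡ E β j
    label {u = u} (l , eq) {w} uw with e∈ , fu , _ ← good u w uw with β′ , j , ψ≡ ← ∈-seeds⁻ e∈
      with refl ← priv∈E⇒≡ {l = l} (subst₂ _∈_ (at-of eq) ψ≡ fu) = j , ψ≡

    label-injective : ∀ {β u v} (iu : InBlock β u) (iv : InBlock β v) {w x} (uw : adj F u w ≡ true) (vx : adj F v x ≡ true) →
                      proj₁ (label iu uw) ≡ proj₁ (label iv vx) → SamePair (u , w) (v , x)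
    label-injective {β} iu iv uw vx eq = ψ-inj _ _ _ _ uw vx
      (trans (proj₂ (label iu uw)) (trans (cong (E β) eq) (sym (proj₂ (label iv vx)))))

    -- Two vertices of F in one block have together at least 2d incidences with edges, labelled with
    -- t values. Only the edge uv can be met twice, so 2d would be at most t + 1, against the degree
    -- condition.
    block-injective : ∀ {β u v} → InBlock β u → InBlock β v → u ≡ v
    block-injective {β} {u} {v} iu iv = decidable-stable (u Fin.≟ v) λ u≢v →
      <⇒≱ t<2d (≤-trans (+-mono-≤ (d≤deg u) (d≤deg v)) (⊎-injective⇒≤ h (h-injective u≢v)))
      where
      x : Fin ∣ nbhd F u ∣ → Fin m
      x = element (nbhd F u)
      y : Fin ∣ nbhd F v ∣ → Fin m
      y = element (nbhd F v)
      ux : ∀ i → adj F u (x i) ≡ true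
      ux i = ∈-nbhd⁻ F (element∈ (nbhd F u) i)
      vy : ∀ i → adj F v (y i) ≡ true
      vy i = ∈-nbhd⁻ F (element∈ (nbhd F v) i)
      h : Fin ∣ nbhd F u ∣ ⊎ Fin ∣ nbhd F v ∣ → Fin (suc t)
      h (inj₁ i) = suc (proj₁ (label iu (ux i)))
      h (inj₂ i) with y i Fin.≟ u
      -- The edge vu is counted with its label on the side of u; its second occurrence gets the
      -- extra value zero, hence `suc t`.
      ... | yes _ = zero
      ... | no  _ = suc (proj₁ (label iv (vy i)))
      h-injective : u ≢ v → ∀ c c′ → h c ≡ h c′ → c ≡ c′
      h-injective u≢v (inj₁ i) (inj₁ i′) eq
        with label-injective iu iu (ux i) (ux i′) (Fin.suc-injective eq)
      ... | inj₁ (_ , eq′)   = cong inj₁ (element-injective (nbhd F u) eq′)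
      ... | inj₂ (eq₁ , eq₂) = cong inj₁ (element-injective (nbhd F u) (trans eq₂ eq₁))
      h-injective u≢v (inj₁ i) (inj₂ i′) eq with y i′ Fin.≟ u
      h-injective u≢v (inj₁ i) (inj₂ i′) eq | no y≢u
        with label-injective iu iv (ux i) (vy i′) (Fin.suc-injective eq)
      ... | inj₁ (u≡v , _) = contradiction u≡v u≢v
      ... | inj₂ (u≡y , _) = contradiction (sym u≡y) y≢u
      h-injective u≢v (inj₂ i) (inj₁ i′) eq with y i Fin.≟ u
      h-injective u≢v (inj₂ i) (inj₁ i′) eq | no y≢u
        with label-injective iv iu (vy i) (ux i′) (Fin.suc-injective eq)
      ... | inj₁ (v≡u , _) = contradiction (sym v≡u) u≢v
      ... | inj₂ (_ , y≡u) = contradiction y≡u y≢u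
      h-injective u≢v (inj₂ i) (inj₂ i′) eq with y i Fin.≟ u | y i′ Fin.≟ u
      h-injective u≢v (inj₂ i) (inj₂ i′) eq | yes y≡u | yes y′≡u =
        cong inj₂ (element-injective (nbhd F v) (trans y≡u (sym y′≡u)))
      h-injective u≢v (inj₂ i) (inj₂ i′) eq | no _ | no _
        with label-injective iv iv (vy i) (vy i′) (Fin.suc-injective eq)
      ... | inj₁ (_ , eq′)   = cong inj₂ (element-injective (nbhd F v) eq′)
      ... | inj₂ (eq₁ , eq₂) = cong inj₂ (element-injective (nbhd F v) (trans eq₂ eq₁))

    InCore : Fin m → Set
    InCore u = ∃ λ i → loc (f u) ≡ core i

    inCore? : Decidable InCore
    inCore? u with loc (f u)
    ... | core i   = yes (i , refl)
    ... | inj₂ _   = no λ ()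

    outer : Subset m
    outer = comprehension (¬? ∘ inCore?)

    locate : ∀ {u β j} → u ∈ outer → f u ∈ E β j → InBlock β u
    locate {u} {β} {j} u∈ fu∈ with E-cases {β} {j} (loc (f u)) (subst (_∈ E β j) (sym (at-loc (f u))) fu∈)
    ... | inj₁ inBlock      = inBlock
    ... | inj₂ (i , eq , _) = contradiction (i , eq) (∈-comprehension⁻ (¬? ∘ inCore?) u∈)

    outer-independent : Independent F outer
    outer-independent u v u∈ v∈ = Bool.¬-not λ uv →
      let e∈ , fu , fv = good u v uv
          β , j , ψ≡ = ∈-seeds⁻ e∈
      in adj⇒≢ F uv (block-injective (locate u∈ (subst (f u ∈_) ψ≡ fu)) (locate v∈ (subst (f v ∈_) ψ≡ fv)))

    inner≤t : ∣ ∁ outer ∣ ≤ t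
    inner≤t = Fin.injective⇒≤ {f = λ i → proj₁ (inner i)} λ {i} {i′} eq → element-injective (∁ outer)
      (f-inj _ _ (loc-injective (trans (proj₂ (inner i)) (trans (cong core eq) (sym (proj₂ (inner i′)))))))
      where
      inner : ∀ i → InCore (element (∁ outer) i)
      inner i = decidable-stable (inCore? _) λ ¬core →
        x∈∁p⇒x∉p (element∈ (∁ outer) i) (∈-comprehension⁺ (¬? ∘ inCore?) ¬core)

  -- A Berge-F from the seeds and a star of new hyperedges

  Normal : Set
  Normal = Fin q × Fin (2 + b)

  normal : Normal → Vertex t q r b
  normal (β , l) = priv (inj₂ β) l

  -- A Berge star whose hyperedges are not seeds, so that the seeds remain free to join vertices to
  -- the core. Centre and leaves lie in distinct normal blocks, where every hyperedge contains all
  -- members of its block.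
  record Star (es : List (Subset n)) (a : ℕ) : Set where
    field
      centre        : Normal
      leaf          : Fin a → Normal
      spoke         : Fin a → Subset n
      spoke∈        : ∀ i → spoke i ∈ˡ es
      spoke∉seeds   : ∀ i → spoke i ∉ˡ seeds
      centre∈       : ∀ i → at (normal centre) ∈ spoke i
      leaf∈         : ∀ i → at (normal (leaf i)) ∈ spoke i
      leaf≢centre   : ∀ i → proj₁ (leaf i) ≢ proj₁ centre
      leaf-distinct : ∀ i j → proj₁ (leaf i) ≡ proj₁ (leaf j) → i ≡ j
      spoke-inj     : ∀ i j → spoke i ≡ spoke j → i ≡ j

  -- Sends S to the leaves, one of the other vertices to the centre and the rest to the core.
  module Embedding (F : Graph m) (S : Subset m) (S-indep : Independent F S)
                   {a : ℕ} (∣S∣≤a : ∣ S ∣ ≤ a) (∣∁S∣≤1+t : ∣ ∁ S ∣ ≤ suc t)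
                   {es : List (Subset n)} (seeds⊆es : ∀ {e} → e ∈ˡ seeds → e ∈ˡ es)
                   (star : Star es a) where
    open Star star

    Role : Set
    Role = Fin (suc t) ⊎ Fin a

    role : Fin m → Role
    role u with u ∈? S
    ... | yes u∈S = inj₂ (inject≤ (rank u∈S) ∣S∣≤a)
    ... | no  u∉S = inj₁ (inject≤ (rank (x∉p⇒x∈∁p u∉S)) ∣∁S∣≤1+t)

    role-injective : ∀ u v → role u ≡ role v → u ≡ v
    role-injective u v eq with u ∈? S | v ∈? S
    ... | yes u∈S | yes v∈S = rank-injective u∈S v∈S (Fin.inject≤-injective ∣S∣≤a ∣S∣≤a _ _ (Sum.inj₂-injective eq))
    ... | no  u∉S | no  v∉S = rank-injective (x∉p⇒x∈∁p u∉S) (x∉p⇒x∈∁p v∉S)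
      (Fin.inject≤-injective ∣∁S∣≤1+t ∣∁S∣≤1+t _ _ (Sum.inj₁-injective eq))

    leaf⇒∈S : ∀ u {i} → role u ≡ inj₂ i → u ∈ S
    leaf⇒∈S u eq with u ∈? S
    ... | yes u∈S = u∈S

    position : Role → Vertex t q r b
    position (inj₁ zero)    = normal centre
    position (inj₁ (suc j)) = core j
    position (inj₂ i)       = normal (leaf i)

    -- The block whose hyperedges join this role to the core. Different roles have different blocks,
    -- so no hyperedge serves two of them.
    block : Role → Block t q
    block (inj₁ zero)    = inj₂ (proj₁ centre)
    block (inj₁ (suc j)) = inj₁ j
    block (inj₂ i)       = inj₂ (proj₁ (leaf i))

    block-injective : ∀ x y → block x ≡ block y → x ≡ y
    block-injective (inj₁ zero)    (inj₁ zero)    eq = refl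
    block-injective (inj₁ zero)    (inj₂ i)       eq = contradiction (sym (Sum.inj₂-injective eq)) (leaf≢centre i)
    block-injective (inj₁ (suc j)) (inj₁ (suc k)) eq = cong (inj₁ ∘ suc) (Sum.inj₁-injective eq)
    block-injective (inj₂ i)       (inj₁ zero)    eq = contradiction (Sum.inj₂-injective eq) (leaf≢centre i)
    block-injective (inj₂ i)       (inj₂ i′)      eq = cong inj₂ (leaf-distinct i i′ (Sum.inj₂-injective eq))

    blockOf : Vertex t q r b → Maybe (Block t q)
    blockOf (core i)   = just (inj₁ i)
    blockOf (priv β l) = just β
    blockOf (spare s)  = nothing

    blockOf-position : ∀ x → blockOf (position x) ≡ just (block x)
    blockOf-position (inj₁ zero)    = refl
    blockOf-position (inj₁ (suc j)) = refl
    blockOf-position (inj₂ i)       = refl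

    position-injective : ∀ x y → position x ≡ position y → x ≡ y
    position-injective x y eq = block-injective x y (just-injective
      (trans (sym (blockOf-position x)) (trans (cong blockOf eq) (blockOf-position y))))

    position∈E : ∀ x j → at (position x) ∈ E (block x) j
    position∈E (inj₁ zero)    j = normal∈E (proj₁ centre) j (proj₂ centre)
    position∈E (inj₁ (suc i)) j = special-core∈E i j
    position∈E (inj₂ i)       j = normal∈E (proj₁ (leaf i)) j (proj₂ (leaf i))

    -- The unordered pairs to be joined: a vertex with a core vertex, or the centre with a leaf.
    Link : Set
    Link = (Role × Fin t) ⊎ Fin a

    ends : Link → Role × Role
    ends (inj₁ (x , j)) = x , inj₁ (suc j)
    ends (inj₂ i)       = inj₁ zero , inj₂ i

    joint : Link → Subset n
    joint (inj₁ (x , j)) = E (block x) j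
    joint (inj₂ i)       = spoke i

    joint∈ : ∀ ℓ → joint ℓ ∈ˡ es × at (position (proj₁ (ends ℓ))) ∈ joint ℓ × at (position (proj₂ (ends ℓ))) ∈ joint ℓ
    joint∈ (inj₁ (x , j)) = seeds⊆es (∈-seeds⁺ (block x) j) , position∈E x j , core∈E (block x) j
    joint∈ (inj₂ i)       = spoke∈ i , centre∈ i , leaf∈ i

    joint-injective : ∀ ℓ ℓ′ → joint ℓ ≡ joint ℓ′ → ℓ ≡ ℓ′
    joint-injective (inj₁ (x , j)) (inj₁ (y , k)) eq with E-injective eq
    ... | eq₁ , refl = cong (λ x → inj₁ (x , j)) (block-injective x y eq₁)
    joint-injective (inj₁ (x , j)) (inj₂ i) eq =
      contradiction (subst (_∈ˡ seeds) eq (∈-seeds⁺ (block x) j)) (spoke∉seeds i)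
    joint-injective (inj₂ i) (inj₁ (x , j)) eq =
      contradiction (subst (_∈ˡ seeds) (sym eq) (∈-seeds⁺ (block x) j)) (spoke∉seeds i)
    joint-injective (inj₂ i) (inj₂ i′) eq = cong inj₂ (spoke-inj i i′ eq)

    -- Two core vertices are joined in the special block of the first, so the value depends on their
    -- order, as `IsBerge` permits.
    hyperedge : Role → Role → Subset n
    hyperedge x                 (inj₁ (suc j))   = joint (inj₁ (x , j))
    hyperedge (inj₁ (suc j))    x@(inj₁ zero)    = joint (inj₁ (x , j))
    hyperedge (inj₁ (suc j))    x@(inj₂ _)       = joint (inj₁ (x , j))
    hyperedge (inj₁ zero)       (inj₂ i)         = joint (inj₂ i)
    hyperedge (inj₂ i)          (inj₁ zero)      = joint (inj₂ i)
    -- Defaults: adjacent vertices have distinct roles, and they are not both leaves since S is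
    -- independent.
    hyperedge (inj₁ zero)       (inj₁ zero)      = ∅
    hyperedge (inj₂ _)          (inj₂ _)         = ∅

    link : ∀ x y → x ≢ y → (∀ {i j} → x ≡ inj₂ i → y ≢ inj₂ j) →
           ∃ λ ℓ → SamePair (x , y) (ends ℓ) × hyperedge x y ≡ joint ℓ
    link x              (inj₁ (suc j)) _ _ = inj₁ (x , j) , inj₁ (refl , refl) , refl
    link (inj₁ (suc j)) (inj₁ zero)    _ _ = inj₁ (inj₁ zero , j) , inj₂ (refl , refl) , refl
    link (inj₁ (suc j)) (inj₂ i)       _ _ = inj₁ (inj₂ i , j) , inj₂ (refl , refl) , refl
    link (inj₁ zero)    (inj₂ i)       _ _ = inj₂ i , inj₁ (refl , refl) , refl
    link (inj₂ i)       (inj₁ zero)    _ _ = inj₂ i , inj₂ (refl , refl) , refl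
    link (inj₁ zero)    (inj₁ zero)    x≢y _ = contradiction refl x≢y
    link (inj₂ _)       (inj₂ _)       _ ¬leaves = contradiction refl (¬leaves refl)

    adj⇒link : ∀ u v → adj F u v ≡ true →
               ∃ λ ℓ → SamePair (role u , role v) (ends ℓ) × hyperedge (role u) (role v) ≡ joint ℓ
    adj⇒link u v uv = link (role u) (role v) (adj⇒≢ F uv ∘ role-injective u v) λ eq₁ eq₂ →
      contradiction (trans (sym uv) (S-indep u v (leaf⇒∈S u eq₁) (leaf⇒∈S v eq₂))) λ ()

    berge : Berge F (_∈ˡ es)
    berge = (λ u → at (position (role u))) , (λ u v → hyperedge (role u) (role v)) ,
      (λ u v eq → role-injective u v (position-injective _ _ (at-injective eq))) ,
      (λ u v uv → let ℓ , same , eq = adj⇒link u v uv in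
         subst (λ e → e ∈ˡ es × at (position (role u)) ∈ e × at (position (role v)) ∈ e) (sym eq)
           (distribute same (joint∈ ℓ))) ,
      λ u v u′ v′ uv uv′ eq →
        let ℓ , same , eq₁ = adj⇒link u v uv
            ℓ′ , same′ , eq₂ = adj⇒link u′ v′ uv′
        in Sum.map (λ (p , q) → role-injective _ _ p , role-injective _ _ q)
                   (λ (p , q) → role-injective _ _ p , role-injective _ _ q)
             (SamePair-trans same (SamePair-trans
               (inj₁ (let eq′ = joint-injective ℓ ℓ′ (trans (sym eq₁) (trans eq eq₂)) in
                  cong (proj₁ ∘ ends) eq′ , cong (proj₂ ∘ ends) eq′))
               (SamePair-sym same′)))
      where
      distribute : ∀ {A : Set} {x y x′ y′ e} → SamePair (x , y) (x′ , y′) →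
        A × at (position x′) ∈ e × at (position y′) ∈ e → A × at (position x) ∈ e × at (position y) ∈ e
      distribute (inj₁ (refl , refl)) p = p
      distribute (inj₂ (refl , refl)) (e∈ , x , y) = e∈ , y , x

  -- Counting the hyperedges when there is no star

  cellAt : Vertex t q r b → Subset n
  cellAt (priv β _) = image (at ∘ priv β)
  cellAt _          = ∅

  -- Forbidding cells in the greedy choice keeps the leaves in distinct blocks. Core and spare
  -- vertices are never chosen, so their cells may be empty.
  cell : Fin n → Subset n
  cell x = cellAt (loc x)

  ∣cell∣≤ : ∀ x → ∣ cell x ∣ ≤ 2 + b
  ∣cell∣≤ x with loc x
  ... | priv β _ = ∣image∣≤ (at ∘ priv β)
  ... | core _   = ≤-trans (≤-reflexive (∣⊥∣≡0 n)) z≤n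
  ... | spare _  = ≤-trans (≤-reflexive (∣⊥∣≡0 n)) z≤n

  ∈-cell : ∀ {x y β l l′} → loc x ≡ priv β l → loc y ≡ priv β l′ → x ∈ cell y
  ∈-cell {x} {y} {β} {l} x≡ y≡ rewrite y≡ =
    subst (_∈ image (at ∘ priv β)) (trans (cong at (sym x≡)) (at-loc x)) (∈-image⁺ (at ∘ priv β) l)

  special : Fin (t * (2 + b)) → Vertex t q r b
  special i = priv (inj₁ (proj₁ (remQuot {t} (2 + b) i))) (proj₂ (remQuot {t} (2 + b) i))

  -- The vertices outside the normal blocks; their number is bounded independently of n as long as r
  -- is.
  exceptional : Subset n
  exceptional = image (at ∘ inj₁) ∪ (image (at ∘ special) ∪ image (λ s → at (spare s)))

  ∣exceptional∣≤ : ∣ exceptional ∣ ≤ t + (t * (2 + b) + r)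
  ∣exceptional∣≤ = ≤-trans (∣p∪q∣≤∣p∣+∣q∣ (image (at ∘ inj₁)) _) (+-mono-≤ (∣image∣≤ _)
    (≤-trans (∣p∪q∣≤∣p∣+∣q∣ (image (at ∘ special)) _) (+-mono-≤ (∣image∣≤ _) (∣image∣≤ _))))

  at-∈ : ∀ {x v} {p : Subset n} → loc x ≡ v → at v ∈ p → x ∈ p
  at-∈ {x} {p = p} eq = subst (_∈ p) (trans (cong at (sym eq)) (at-loc x))

  ∉exceptional⇒normal : ∀ {x} → x ∉ exceptional → ∃ λ y → loc x ≡ normal y
  ∉exceptional⇒normal {x} x∉ with loc x in eq
  ... | core i          = contradiction (x∈p∪q⁺ (inj₁ (at-∈ eq (∈-image⁺ (at ∘ inj₁) i)))) x∉
  ... | spare s         = contradiction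
    (x∈p∪q⁺ (inj₂ (x∈p∪q⁺ (inj₂ (at-∈ eq (∈-image⁺ (λ s → at (spare s)) s)))))) x∉
  ... | priv (inj₂ β) l = (β , l) , refl
  ... | priv (inj₁ i) l = contradiction
    (x∈p∪q⁺ (inj₂ (x∈p∪q⁺ (inj₁ (at-∈ (trans eq (cong (λ (i , l) → priv (inj₁ i) l) (sym (Fin.remQuot-combine i l))))
      (∈-image⁺ (at ∘ special) (combine i l))))))) x∉

  module Count {a : ℕ} (es : List (Subset n)) (uniq : Unique es) (size : All (λ e → ∣ e ∣ ≡ 3 + b) es)
               (starless : ¬ Star es a) where

    New : Fin n → Subset n → Set
    New x e = e ∉ˡ seeds × x ∈ e × x ∉ exceptional

    new? : ∀ x → Decidable (New x)
    new? x e = ¬? (e ∈ˡ? seeds) ×-dec (x ∈? e) ×-dec ¬? (x ∈? exceptional)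

    new : Fin n → List (Subset n)
    new x = filter (new? x) es

    ∈-new⁻ : ∀ {x e} → e ∈ˡ new x → e ∈ˡ es × New x e
    ∈-new⁻ {x} = ∈-filter⁻ (new? x)

    -- `step` bounds what one greedy choice forbids: a hyperedge of k vertices and a block of k - 1.
    -- `K` allows for `a` such steps after the set forbidden at the start, the exceptional vertices
    -- and the block of the centre.
    step K : ℕ
    step = (3 + b) + (2 + b)
    K    = ((t + (t * (2 + b) + r)) + (2 + b)) + a * step

    many-new⇒Star : ∀ x → 2 ^ K < length (new x) → Star es a
    many-new⇒Star x large = record
      { centre = c ; leaf = proj₁ ∘ y≡ ; spoke = e
      ; spoke∈ = proj₁ ∘ e∈ ; spoke∉seeds = proj₁ ∘ proj₂ ∘ e∈
      ; centre∈ = λ i → subst (_∈ e i) (sym (at-normal c≡)) (proj₁ (proj₂ (proj₂ (e∈ i))))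
      ; leaf∈ = λ i → subst (_∈ e i) (sym (at-normal (proj₂ (y≡ i)))) (proj₁ (proj₂ (good i)))
      ; leaf≢centre = λ i eq → y∉ i (x∈p∪q⁺ (inj₂ (same-cell (proj₂ (y≡ i)) c≡ eq)))
      ; leaf-distinct = λ i j eq → decidable-stable (i Fin.≟ j) λ i≢j →
          [ (λ ∉cell → ∉cell (same-cell (proj₂ (y≡ i)) (proj₂ (y≡ j)) eq))
          , (λ ∉cell → ∉cell (same-cell (proj₂ (y≡ j)) (proj₂ (y≡ i)) (sym eq))) ]′ (apart i j i≢j)
      ; spoke-inj = e-inj }
      where
      choose : ∀ Q → ∣ Q ∣ ≤ K → ∃₂ λ e y → e ∈ˡ new x × y ∈ e × y ∉ Q
      choose = avoiding-edge (filter⁺ (new? x) uniq) large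

      -- A single member of `new x` already certifies that x is not exceptional.
      some = choose ∅ (≤-trans (≤-reflexive (∣⊥∣≡0 n)) z≤n)

      x∉exceptional : x ∉ exceptional
      x∉exceptional = proj₂ (proj₂ (proj₂ (∈-new⁻ {x} (proj₁ (proj₂ (proj₂ some))))))

      c  = proj₁ (∉exceptional⇒normal x∉exceptional)
      c≡ = proj₂ (∉exceptional⇒normal x∉exceptional)

      star = greedy cell step K (new x)
        (λ {e} y e∈ → ≤-trans (∣p∪q∣≤∣p∣+∣q∣ e (cell y))
          (+-mono-≤ (≤-reflexive (All.lookup size (proj₁ (∈-new⁻ {x} e∈)))) (∣cell∣≤ y)))
        choose a (exceptional ∪ cell x)
        (+-monoˡ-≤ (a * step) (≤-trans (∣p∪q∣≤∣p∣+∣q∣ exceptional (cell x)) (+-mono-≤ ∣exceptional∣≤ (∣cell∣≤ x))))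

      e : Fin a → Subset n
      e = proj₁ star
      y : Fin a → Fin n
      y = proj₁ (proj₂ star)
      good  = proj₁ (proj₂ (proj₂ star))
      e-inj = proj₁ (proj₂ (proj₂ (proj₂ star)))
      apart = proj₂ (proj₂ (proj₂ (proj₂ star)))

      e∈ : ∀ i → e i ∈ˡ es × New x (e i)
      e∈ i = ∈-new⁻ {x} (proj₁ (good i))

      y∉ : ∀ i → y i ∉ exceptional ∪ cell x
      y∉ i = proj₂ (proj₂ (good i))

      y≡ : ∀ i → ∃ λ z → loc (y i) ≡ normal z
      y≡ i = ∉exceptional⇒normal (y∉ i ∘ x∈p∪q⁺ ∘ inj₁)

      at-normal : ∀ {z w} → loc z ≡ normal w → at (normal w) ≡ z
      at-normal {z} eq = trans (cong at (sym eq)) (at-loc z)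

      same-cell : ∀ {z z′ w w′} → loc z ≡ normal w → loc z′ ≡ normal w′ → proj₁ w ≡ proj₁ w′ → z ∈ cell z′
      same-cell eq eq′ refl = ∈-cell eq eq′

    length-new : ∀ x → length (new x) ≤ 2 ^ K
    length-new x = ≮⇒≥ (starless ∘ many-new⇒Star x)

    -- A hyperedge is a seed, or consists of exceptional vertices only, or is new at one of its
    -- other vertices; the three summands bound these kinds.
    length-edges : length es ≤ n * t + (2 ^ (t + (t * (2 + b) + r)) + n * 2 ^ K)
    length-edges = ≤-trans (Unique⇒length≤ uniq covered)
      (≤-trans (≤-reflexive (trans (length-++ seeds) (cong (length seeds +_) (length-++ (powerset exceptional)))))
        (+-mono-≤ length-seeds (+-mono-≤
          (≤-trans (≤-reflexive (length-powerset exceptional)) (^-monoʳ-≤ 2 ∣exceptional∣≤))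
          (≤-trans (length-concatMap≤ new (2 ^ K) length-new (allFin n))
            (*-monoˡ-≤ (2 ^ K) (≤-reflexive (length-tabulate {n = n} id)))))))
      where
      covered : ∀ {e} → e ∈ˡ es → e ∈ˡ seeds ++ (powerset exceptional ++ concatMap new (allFin n))
      covered {e} e∈ with e ∈ˡ? seeds
      ... | yes e∈seeds = ∈-++⁺ˡ e∈seeds
      ... | no e∉seeds with Fin.any? (λ x → (x ∈? e) ×-dec ¬? (x ∈? exceptional))
      ...   | yes (x , x∈e , x∉) = ∈-++⁺ʳ seeds (∈-++⁺ʳ (powerset exceptional) (∈-concatMap⁺ new
        (Any.map (λ { refl → ∈-filter⁺ (new? x) e∈ (e∉seeds , x∈e , x∉) }) (∈-allFin x))))
      ...   | no none = ∈-++⁺ʳ seeds (∈-++⁺ˡ (∈-powerset λ {x} x∈e →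
        decidable-stable (x ∈? exceptional) λ x∉ → none (x , x∈e , x∉)))

-- Dividing n vertices into core, blocks and spare vertices

vertices↔ : (t q r b : ℕ) → Fin (t + ((t + q) * (2 + b) + r)) ↔ Vertex t q r b
vertices↔ t q r b = ↔-trans Fin.+↔⊎ (↔-refl ⊎-↔ ↔-trans Fin.+↔⊎ (↔-trans Fin.*↔× (Fin.+↔⊎ ×-↔ ↔-refl) ⊎-↔ ↔-refl))

-- The core and the t special blocks are set aside; the quotient of the rest by the block size
-- counts the normal blocks, the remainder the spare vertices.
layout : (t b n : ℕ) → t + t * (2 + b) ≤ n →
         ∃₂ λ q r → r ≤ 2 + b × n ≡ t + ((t + q) * (2 + b) + r)
layout t b n t+ts≤n = rest / s , rest % s , <⇒≤ (m%n<n rest s) , (begin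
  n                                          ≡⟨ m+[n∸m]≡n t+ts≤n ⟨
  (t + t * s) + rest                         ≡⟨ +-assoc t (t * s) rest ⟩
  t + (t * s + rest)                         ≡⟨ cong (λ x → t + (t * s + x)) (trans (m≡m%n+[m/n]*n rest s) (+-comm (rest % s) _)) ⟩
  t + (t * s + (rest / s * s + rest % s))    ≡⟨ cong (t +_) (+-assoc (t * s) (rest / s * s) (rest % s)) ⟨
  t + ((t * s + rest / s * s) + rest % s)    ≡⟨ cong (λ x → t + (x + rest % s)) (*-distribʳ-+ s t (rest / s)) ⟨
  t + ((t + rest / s) * s + rest % s)        ∎)
  where
  open ≡-Reasoning
  s rest : ℕ
  s    = 2 + b
  rest = n ∸ (t + t * s)

-- A `Star` in the saturated hypergraph would complete a Berge-F with the seeds, so there is none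
-- and `Count` applies.
saturated-with-few-edges : (F : Graph m) (S : Subset m) → Independent F S →
  (∀ T → Independent F T → ∣ T ∣ ≤ ∣ S ∣) → (d : ℕ) → (∀ v → d ≤ deg F v) →
  ∀ {t} → ∣ ∁ S ∣ ≡ suc t → suc t < d + d → ∀ q r b {n} → Fin n ↔ Vertex t q r b →
  Σ (Hypergraph (3 + b) n) λ H → BergeSaturated F H × numEdges H ≤
    n * t + (2 ^ (t + (t * (2 + b) + r)) +
             n * 2 ^ (((t + (t * (2 + b) + r)) + (2 + b)) + ∣ S ∣ * ((3 + b) + (2 + b))))
saturated-with-few-edges {m} F S S-indep S-max d d≤deg {t} cover t<2d q r b iso =
  let H , base⊆H , free , sat = saturated-extension F base base-size base-unique base-free
  in H , sat , Count.length-edges (edges H) (simple H) (uniform H)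
       (free ∘ Embedding.berge F S S-indep ≤-refl (≤-reflexive cover) (base⊆H ∘ ∈-deduplicate⁺ _≟ˢ_))
  where
  open Construction t q r b iso
  -- `saturated-extension` asks for distinct hyperedges.
  base = deduplicate _≟ˢ_ seeds
  base-unique = deduplicate-! _≟ˢ_ seeds
  base-size : All (λ e → ∣ e ∣ ≡ 3 + b) base
  base-size = All.tabulate λ e∈ → let β , j , eq = ∈-seeds⁻ (∈-deduplicate⁻ _≟ˢ_ seeds e∈) in
    trans (cong ∣_∣ eq) (∣E∣ β j)
  S+t<m : ∣ S ∣ + t < m
  S+t<m = ≤-reflexive (trans (sym (+-suc ∣ S ∣ t))
    (trans (cong (∣ S ∣ +_) (trans (sym cover) (∣∁p∣≡n∸∣p∣ S))) (m+[n∸m]≡n (∣p∣≤n S))))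
  base-free : ¬ Berge F (_∈ˡ base)
  base-free = seeds-free F d ∣ S ∣ d≤deg S-max t<2d S+t<m ∘ Berge-mono F {_∈ˡ base} (∈-deduplicate⁻ _≟ˢ_ seeds)

-- The parameters of F and the linear bound

independence-number : (F : Graph m) → ∃ λ S → Independent F S × (∀ T → Independent F T → ∣ T ∣ ≤ ∣ S ∣)
independence-number {m} F = S , argmax-all ∣_∣ (λ _ _ u∈∅ → contradiction u∈∅ ∉⊥) (All.all-filter independent? (powerset full)) ,
  λ T T-indep → All.lookup (f[xs]≤f[argmax] ∅ _) (∈-filter⁺ independent? (∈-powerset ⊆⊤) T-indep)
  where
  independent? : Decidable (Independent F)
  independent? S = Fin.all? λ u → Fin.all? λ v → (u ∈? S) →-dec (v ∈? S) →-dec (adj F u v Bool.≟ false)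
  S : Subset m
  S = argmax ∣_∣ ∅ (filter independent? (powerset full))

minimum-degree : (F : Graph m) → Fin m → ∃ λ v → ∀ u → deg F v ≤ deg F u
minimum-degree F v = argmin (deg F) v (allFin _) , λ u → All.lookup (f[argmin]≤f[xs] v (allFin _)) (∈-allFin u)

-- If S contained all vertices, an edge of F would lie in it. Thus t = |V(F)| - a - 1 is a natural
-- number.
independent⇒∁-nonempty : (F : Graph m) → HasEdge F → ∀ S → Independent F S → ∃ λ t → ∣ ∁ S ∣ ≡ suc t
independent⇒∁-nonempty F (u , v , uv) S S-indep with ∣ ∁ S ∣ in cover
... | suc t = t , refl
... | zero  = contradiction (trans (sym uv) (S-indep u v (all∈S u) (all∈S v))) λ ()
  where
  all∈S : ∀ w → w ∈ S
  all∈S w = decidable-stable (w ∈? S) λ w∉S → Fin.¬Fin0 (subst Fin cover (rank (x∉p⇒x∈∁p w∉S)))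

theorem1p3 : ∀ {m} (F : Graph m) → HasEdge F → NoIsolatedVertices F → DegreeCondition F →
    ∀ (k : ℕ) → 3 ≤ k →
    ∃[ C ] ∃[ N ] (∀ n → N ≤ n → Σ (Hypergraph k n) λ H → BergeSaturated F H × numEdges H ≤ C * n)
theorem1p3 {m} F hasEdge _ degreeCondition (suc (suc (suc b))) (s≤s (s≤s (s≤s z≤n))) =
  -- The summands account for the seeds, the hyperedges within the exceptional vertices and the new
  -- ones at normal vertices. The threshold leaves room for the core and the special blocks; its
  -- successor makes n positive, so that `Z` is at most `Z * n`.
  t + Z + B , suc (t + t * (2 + b)) , λ n N≤n →
    let q , r , r≤ , n≡ = layout t b n (<⇒≤ N≤n)
        H , sat , few = saturated-with-few-edges F S S-indep S-max d d≤deg cover t<2d q r b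
          (subst (λ n → Fin n ↔ Vertex t q r b) (sym n≡) (vertices↔ t q r b))
    in H , sat , ≤-trans few (linear n r (≤-trans (s≤s z≤n) N≤n) r≤)
  where
  S = proj₁ (independence-number F)
  S-indep = proj₁ (proj₂ (independence-number F))
  S-max = proj₂ (proj₂ (independence-number F))
  v = proj₁ (minimum-degree F (proj₁ hasEdge))
  d≤deg = proj₂ (minimum-degree F (proj₁ hasEdge))
  t = proj₁ (independent⇒∁-nonempty F hasEdge S S-indep)
  cover = proj₂ (independent⇒∁-nonempty F hasEdge S S-indep)
  d z Z B : ℕ
  d = deg F v
  -- The number r of spare vertices is replaced by its bound 2 + b, which makes the constants
  -- independent of n.
  z = t + (t * (2 + b) + (2 + b))
  Z = 2 ^ z
  B = 2 ^ ((z + (2 + b)) + ∣ S ∣ * ((3 + b) + (2 + b)))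

  t<2d : suc t < d + d
  t<2d = subst₂ _<_ (trans (sym (∣∁p∣≡n∸∣p∣ S)) cover) (cong (d +_) (+-identityʳ d))
    (degreeCondition d ∣ S ∣ ((v , refl) , d≤deg) ((S , S-indep , refl) , S-max))

  linear : ∀ n r → 0 < n → r ≤ 2 + b →
    n * t + (2 ^ (t + (t * (2 + b) + r)) +
             n * 2 ^ (((t + (t * (2 + b) + r)) + (2 + b)) + ∣ S ∣ * ((3 + b) + (2 + b)))) ≤ (t + Z + B) * n
  linear n@(suc _) r _ r≤ = begin
    n * t + (2 ^ z′ + n * 2 ^ ((z′ + (2 + b)) + c))
      ≤⟨ +-monoʳ-≤ (n * t) (+-mono-≤ (^-monoʳ-≤ 2 z′≤z)
           (*-monoʳ-≤ n (^-monoʳ-≤ 2 (+-monoˡ-≤ c (+-monoˡ-≤ (2 + b) z′≤z))))) ⟩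
    n * t + (Z + n * B)      ≤⟨ +-monoʳ-≤ (n * t) (+-monoˡ-≤ (n * B) (m≤m*n Z n)) ⟩
    n * t + (Z * n + n * B)  ≡⟨ cong₂ (λ x y → x + (Z * n + y)) (*-comm n t) (*-comm n B) ⟩
    t * n + (Z * n + B * n)  ≡⟨ +-assoc (t * n) (Z * n) (B * n) ⟨
    t * n + Z * n + B * n    ≡⟨ cong (_+ B * n) (*-distribʳ-+ n t Z) ⟨
    (t + Z) * n + B * n      ≡⟨ *-distribʳ-+ n (t + Z) B ⟨
    (t + Z + B) * n          ∎
    where
    open ≤-Reasoning
    c  = ∣ S ∣ * ((3 + b) + (2 + b))
    z′ = t + (t * (2 + b) + r)
    z′≤z : z′ ≤ z
    z′≤z = +-monoʳ-≤ t (+-monoʳ-≤ (t * (2 + b)) r≤)
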